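{- For any integer $n \geq 0$ (with $a$ denoting a nonnegative integer), $$v_2(B_n(4,3)) = \begin{cases} 1 + 2 v_2(a), & \text{if } n=5a \text{ and } v_2(a) \leq 2, \\ 1 + v_2 \big( a(a+1) \big), & \text{if } n = 5a+1 \text{ and } v_2 \big( a(a+1) \big) \leq 5, \\ 3, & \text{if } n=5a + 2 \text{ and } v_2(a-1) \geq 2, \\ 0, & \text{if } n \equiv 3 \pmod{5}, \\ 0, & \text{if } n \equiv 4 \pmod{5}. \end{cases}$$ (No assertion is made for values of $n$ not covered by these cases.)
   Context: The sequence $\{B_n(4,3)\}_{n\geq 0}$ is defined by $B_n = B_{n-1}+B_{n-2}+B_{n-3}+B_{n-4}$ for $n \geq 4$, with $(B_0,B_1,B_2,B_3)=(0,0,0,1)$. $v_2$ denotes the 2-adic order (2-adic valuation), with the convention $v_2(0)=+\infty$. -}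

module Defs where

open import Data.Integer.Base using (ℤ; +_; -[1+_]; ∣_∣; NonZero)
open import Data.Nat.Base using (ℕ; zero; suc; _+_; _^_; _≤_; _<_; z≤n; s≤s)
open import Data.Nat.Divisibility using (_∣_; _∣?_; 1∣_; ∣⇒≤)
open import Data.Nat.Properties using (≤-trans; ≤-pred; <⇒≤; m≤n⇒m<n∨m≡n; +-mono-≤; +-identityʳ; m^n>0)
open import Data.Product.Base using (∃-syntax; _×_; _,_)
open import Data.Sum.Base using (inj₁; inj₂)
open import Relation.Binary.PropositionalEquality.Core using (_≡_; refl; sym; subst)
open import Relation.Nullary.Construct.Add.Supremum using (_⁺; ⊤⁺; [_]) public
open import Relation.Nullary.Decidable.Core using (yes; no)
open import Relation.Nullary.Negation.Core using (contradiction)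
open import Relation.Binary.Construct.Add.Supremum.NonStrict _≤_ using (_≤⁺_; [_]; _≤⊤⁺) public

B : ℕ → ℕ
B 0 = 0
B 1 = 0
B 2 = 0
B 3 = 1
B (suc (suc (suc (suc n)))) = B (suc (suc (suc n))) + B (suc (suc n)) + B (suc n) + B n

ℕ∞ : Set
ℕ∞ = ℕ ⁺

infixl 6 _+∞_
infixl 7 _·∞_

_+∞_ : ℕ∞ → ℕ∞ → ℕ∞
[ m ] +∞ [ n ] = [ m + n ]
[ m ] +∞ ⊤⁺    = ⊤⁺
⊤⁺    +∞ _     = ⊤⁺

_·∞_ : ℕ → ℕ∞ → ℕ∞
zero  ·∞ x = [ 0 ]
suc k ·∞ x = x +∞ k ·∞ x

-- The greatest k ≤ b with 2 ^ k ∣ n.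
maxExponent : (n b : ℕ) → ℕ
maxExponent n zero    = 0
maxExponent n (suc b) with 2 ^ suc b ∣? n
... | yes _ = suc b
... | no  _ = maxExponent n b

-- For i ≠ 0, 2 ^ k ∣ i implies k < 2 ^ k ≤ ∣ i ∣, so ∣ i ∣ bounds the search;
-- see v₂-finite.
v₂ : ℤ → ℕ∞
v₂ (+ 0)       = ⊤⁺
v₂ i@(+ suc _) = [ maxExponent ∣ i ∣ ∣ i ∣ ]
v₂ i@(-[1+ _ ]) = [ maxExponent ∣ i ∣ ∣ i ∣ ]

maxExponent-∣ : ∀ n b → 2 ^ maxExponent n b ∣ n
maxExponent-∣ n zero = 1∣ n
maxExponent-∣ n (suc b) with 2 ^ suc b ∣? n
... | yes p = p
... | no  _ = maxExponent-∣ n b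

maxExponent-greatest : ∀ n b {k} → k ≤ b → 2 ^ k ∣ n → k ≤ maxExponent n b
maxExponent-greatest n zero    k≤b _ = k≤b
maxExponent-greatest n (suc b) k≤b d with 2 ^ suc b ∣? n | m≤n⇒m<n∨m≡n k≤b
... | yes _ | _           = k≤b
... | no ¬p | inj₁ k<1+b  = maxExponent-greatest n b (≤-pred k<1+b) d
... | no ¬p | inj₂ refl   = contradiction d ¬p

n<2^n : ∀ n → n < 2 ^ n
n<2^n zero    = s≤s z≤n
n<2^n (suc n) = +-mono-≤ (m^n>0 2 n) (subst (suc n ≤_) (sym (+-identityʳ (2 ^ n))) (n<2^n n))

v₂-finite : ∀ i → .{{_ : NonZero i}} →
  ∃[ k ] (v₂ i ≡ [ k ]) × (2 ^ k ∣ ∣ i ∣) × (∀ j → 2 ^ j ∣ ∣ i ∣ → j ≤ k)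
v₂-finite i@(+ suc _)  = _ , refl , maxExponent-∣ ∣ i ∣ ∣ i ∣ , λ j d →
  maxExponent-greatest ∣ i ∣ ∣ i ∣ (≤-trans (<⇒≤ (n<2^n j)) (∣⇒≤ d)) d
v₂-finite i@(-[1+ _ ]) = _ , refl , maxExponent-∣ ∣ i ∣ ∣ i ∣ , λ j d →
  maxExponent-greatest ∣ i ∣ ∣ i ∣ (≤-trans (<⇒≤ (n<2^n j)) (∣⇒≤ d)) d

{-# OPTIONS --safe #-}

-- Modulo 2ᵏ the sequence B is purely periodic: modulo 2 with period 5, modulo 128
-- with period 320.  A 2-adic order below k is determined by the residue modulo 2ᵏ,
-- and every order asserted here is below 7, so each case reduces to a check over
-- one period.
module Submission where

open import Data.Integer.Base using (+_; _-_; 1ℤ)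
open import Data.Nat.Base using (ℕ; zero; suc; _+_; _*_; _%_; _/_; _^_; _≤_; _<_; z≤n; s≤s; NonZero)
open import Data.Nat.Divisibility using (_∣_; _∣?_; _∣0; m∣m*n; ∣-trans; %-presˡ-∣; ∣n∣m%n⇒∣m)
open import Data.Nat.DivMod using (%-distribˡ-+; [m+kn]%n≡m%n; m%n<n; m≡m%n+[m/n]*n)
open import Data.Nat.Properties
open import Data.Nat.Tactic.RingSolver using (solve-∀)
open import Data.Product.Base using (_×_; _,_; proj₂)
open import Data.Sum.Base using (inj₁; inj₂)
open import Relation.Binary.PropositionalEquality
open import Relation.Nullary.Decidable.Core using (yes; no; toWitness; _→-dec_)
open import Relation.Nullary.Negation.Core using (contradiction)
open import Defs

^-monoʳ-∣ : ∀ m {n o} → n ≤ o → m ^ n ∣ m ^ o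
^-monoʳ-∣ m {n} n≤o with m≤n⇒∃[o]m+o≡n n≤o
... | k , refl = subst (m ^ n ∣_) (sym (^-distribˡ-+-* m n k)) (m∣m*n (m ^ k))

maxExponent≤bound : ∀ n b → maxExponent n b ≤ b
maxExponent≤bound n zero = z≤n
maxExponent≤bound n (suc b) with 2 ^ suc b ∣? n
... | yes _ = ≤-refl
... | no  _ = m≤n⇒m≤1+n (maxExponent≤bound n b)

-- `maxExponent n k` is the order of `n` truncated at `k`. Each exponent `j ≤ k` has 2 ^ j dividing
-- 2 ^ k, so divisibility by 2 ^ j survives reduction modulo 2 ^ k.
maxExponent-cong-% : ∀ m n k .{{_ : NonZero (2 ^ k)}} →
  m % 2 ^ k ≡ n % 2 ^ k → maxExponent m k ≡ maxExponent n k
maxExponent-cong-% m n k eq = ≤-antisym (below m n eq) (below n m (sym eq))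
  where
  below : ∀ m n → m % 2 ^ k ≡ n % 2 ^ k → maxExponent m k ≤ maxExponent n k
  below m n eq = maxExponent-greatest n k (maxExponent≤bound m k)
    (∣n∣m%n⇒∣m d (subst (_ ∣_) eq (%-presˡ-∣ (maxExponent-∣ m k) d)))
    where d = ^-monoʳ-∣ 2 (maxExponent≤bound m k)

-- Truncation loses information only on reaching its bound: a true order of at least `k`, infinite
-- for `n = 0`, would push the truncated one up to `k`.
maxExponent<bound⇒v₂ : ∀ n k → maxExponent n k < k → v₂ (+ n) ≡ [ maxExponent n k ]
maxExponent<bound⇒v₂ zero k lt =
  contradiction (maxExponent-greatest 0 k ≤-refl (_ ∣0)) (<⇒≱ lt)
maxExponent<bound⇒v₂ n@(suc _) k lt with v₂-finite (+ n)
... | e , eq , d , max = trans eq (cong [_] (≤-antisym e≤ (max _ (maxExponent-∣ n k))))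
  where
  e≤ : e ≤ maxExponent n k
  e≤ with ≤-total e k
  ... | inj₁ e≤k = maxExponent-greatest n k e≤k d
  ... | inj₂ k≤e = contradiction
    (maxExponent-greatest n k ≤-refl (∣-trans (^-monoʳ-∣ 2 k≤e) d)) (<⇒≱ lt)

v₂-from-maxExponent : ∀ {n e} k → maxExponent n k ≡ e → e < k → v₂ (+ n) ≡ [ e ]
v₂-from-maxExponent k refl = maxExponent<bound⇒v₂ _ k

v₂≤⇒maxExponent≤ : ∀ n k {m} → v₂ (+ n) ≤⁺ [ m ] → maxExponent n k ≤ m
-- Zero cannot occur: `v₂ (+ 0)` is `⊤⁺`, which no `[ m ]` bounds.
v₂≤⇒maxExponent≤ n@(suc _) k [ v≤m ] =
  ≤-trans (proj₂ (proj₂ (proj₂ (v₂-finite (+ n)))) _ (maxExponent-∣ n k)) v≤m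

-- A lower bound on the order saturates the truncation. Zero must be covered too: in the case n = 5a
-- + 2 it arises as a - 1 for a = 1.
≤v₂⇒maxExponent≡ : ∀ n k → [ k ] ≤⁺ v₂ (+ n) → maxExponent n k ≡ k
≤v₂⇒maxExponent≡ zero k _ =
  ≤-antisym (maxExponent≤bound 0 k) (maxExponent-greatest 0 k ≤-refl (_ ∣0))
≤v₂⇒maxExponent≡ n@(suc _) k [ k≤v ] = ≤-antisym (maxExponent≤bound n k)
  (maxExponent-greatest n k ≤-refl (∣-trans (^-monoʳ-∣ 2 k≤v) (maxExponent-∣ n n)))

periodic⇒% : ∀ {ℓ} {A : Set ℓ} (f : ℕ → A) p .{{_ : NonZero p}} →
  (∀ n → f (n + p) ≡ f n) → ∀ n → f n ≡ f (n % p)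
periodic⇒% f p f-per n = trans (cong f (m≡m%n+[m/n]*n n p)) (shift (n / p) (n % p))
  where
  shift : ∀ q n → f (n + q * p) ≡ f n
  shift zero    n = cong f (+-identityʳ n)
  shift (suc q) n = trans (cong f (sym (+-assoc n p (q * p))))
    (trans (shift q (n + p)) (f-per n))

-- B itself recurses four ways and cannot be evaluated at 320; B-iter carries four
-- consecutive terms instead.
run : (w x y z n : ℕ) → ℕ
run w x y z zero    = w
run w x y z (suc n) = run x y z (z + y + x + w) n

B-iter : ℕ → ℕ
B-iter = run 0 0 0 1

B≗B-iter : ∀ n → B n ≡ B-iter n
B≗B-iter n = trans (cong B (sym (+-identityʳ n))) (sym (run-B n 0))
  where
  run-B : ∀ n m → run (B m) (B (1 + m)) (B (2 + m)) (B (3 + m)) n ≡ B (n + m)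
  run-B zero    m = refl
  -- One step of `run` moves the window from `m` to `suc m`: its new entry is definitionally
  -- `B (4 + m)`.
  run-B (suc n) m = trans (run-B n (suc m)) (cong B (+-suc n m))

+-cong-% : ∀ m {a b c d} .{{_ : NonZero m}} →
  a % m ≡ b % m → c % m ≡ d % m → (a + c) % m ≡ (b + d) % m
+-cong-% m {a} {b} {c} {d} eq eq′ = trans (%-distribˡ-+ a c m)
  (trans (cong₂ (λ x y → (x + y) % m) eq eq′) (sym (%-distribˡ-+ b d m)))

-- Addition respects congruence, so the recurrence propagates agreement from the four initial terms.
-- These are compared through `B-iter` so that the check can be evaluated.
B-periodic : ∀ m p .{{_ : NonZero m}} →
  (∀ {i} → i < 4 → B-iter (i + p) % m ≡ B-iter i % m) →
  ∀ n → B (n + p) % m ≡ B n % m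
B-periodic m p init = go
  where
  base : ∀ i → i < 4 → B (i + p) % m ≡ B i % m
  base i i<4 = trans (cong (_% m) (B≗B-iter (i + p)))
    (trans (init i<4) (cong (_% m) (sym (B≗B-iter i))))

  go : ∀ n → B (n + p) % m ≡ B n % m
  go 0 = base 0 (s≤s z≤n)
  go 1 = base 1 (s≤s (s≤s z≤n))
  go 2 = base 2 (s≤s (s≤s (s≤s z≤n)))
  go 3 = base 3 (s≤s (s≤s (s≤s (s≤s z≤n))))
  go (suc (suc (suc (suc n)))) =
    +-cong-% m (+-cong-% m (+-cong-% m (go (suc (suc (suc n)))) (go (suc (suc n)))) (go (suc n))) (go n)

B-periodic-128 : ∀ n → B (n + 320) % 128 ≡ B n % 128
B-periodic-128 = B-periodic 128 320
  (toWitness {a? = allUpTo? (λ i → B-iter (i + 320) % 128 ≟ B-iter i % 128) 4} _)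

B-periodic-2 : ∀ n → B (n + 5) % 2 ≡ B n % 2
B-periodic-2 = B-periodic 2 5
  (toWitness {a? = allUpTo? (λ i → B-iter (i + 5) % 2 ≟ B-iter i % 2) 4} _)

-- Since 320 = 5 * 64, moving `a` by 64 moves the index by one period modulo 128 = 2 ^ 7.
maxExponent-B : ∀ r a →
  maxExponent (B (5 * a + r)) 7 ≡ maxExponent (B-iter (5 * (a % 64) + r)) 7
maxExponent-B r a = trans
  (periodic⇒% (λ a → maxExponent (B (5 * a + r)) 7) 64 periodic a)
  (cong (λ x → maxExponent x 7) (B≗B-iter (5 * (a % 64) + r)))
  where
  shift : ∀ a p r → 5 * (a + p) + r ≡ 5 * a + r + 5 * p
  shift = solve-∀

  periodic : ∀ a → maxExponent (B (5 * (a + 64) + r)) 7 ≡ maxExponent (B (5 * a + r)) 7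
  periodic a = maxExponent-cong-% (B (5 * (a + 64) + r)) (B (5 * a + r)) 7
    (trans (cong (λ n → B n % 128) (shift a 64 r)) (B-periodic-128 (5 * a + r)))

-- The factor `q` stretches the period 2 ^ k to 64, so that a hypothesis on `a` and the order of `B`
-- reduce to the same residue of `a`.
maxExponent-% : ∀ k q .{{_ : NonZero (2 ^ k)}} .{{_ : NonZero (q * 2 ^ k)}} →
  ∀ a → maxExponent a k ≡ maxExponent (a % (q * 2 ^ k)) k
maxExponent-% k q = periodic⇒% (λ a → maxExponent a k) (q * 2 ^ k)
  (λ a → maxExponent-cong-% (a + q * 2 ^ k) a k ([m+kn]%n≡m%n a q (2 ^ k)))

maxExponent-a[a+1]-% : ∀ k .{{_ : NonZero (2 ^ k)}} →
  ∀ a → maxExponent (a * (a + 1)) k ≡ maxExponent (a % 2 ^ k * (a % 2 ^ k + 1)) k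
maxExponent-a[a+1]-% k = periodic⇒% (λ a → maxExponent (a * (a + 1)) k) (2 ^ k)
  (λ a → maxExponent-cong-% _ _ k (trans (cong (_% 2 ^ k) (expand a (2 ^ k)))
    ([m+kn]%n≡m%n (a * (a + 1)) (2 * a + 1 + 2 ^ k) (2 ^ k))))
  where
  expand : ∀ a p → (a + p) * (a + p + 1) ≡ a * (a + 1) + (2 * a + 1 + p) * p
  expand = solve-∀

-- Truncation at 3 suffices to express v₂(a) ≤ 2. The whole implication depends only on `a % 64`, so
-- it is decided on 64 residues and transported back to `a`.
maxExponent-B[5a] : ∀ a → maxExponent a 3 < 3 →
  maxExponent (B (5 * a + 0)) 7 ≡ 1 + 2 * maxExponent a 3
maxExponent-B[5a] a = subst₂ (λ x y → x < 3 → y ≡ 1 + 2 * x)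
  (sym (maxExponent-% 3 8 a)) (sym (maxExponent-B 0 a))
  (toWitness {a? = allUpTo? (λ a → maxExponent a 3 <? 3
    →-dec maxExponent (B-iter (5 * a + 0)) 7 ≟ 1 + 2 * maxExponent a 3) 64} _ (m%n<n a 64))

-- The largest order asserted, 1 + 5 = 6, occurs here and calls for the modulus 2 ^ 7.
maxExponent-B[5a+1] : ∀ a → maxExponent (a * (a + 1)) 6 < 6 →
  maxExponent (B (5 * a + 1)) 7 ≡ 1 + maxExponent (a * (a + 1)) 6
maxExponent-B[5a+1] a = subst₂ (λ x y → x < 6 → y ≡ 1 + x)
  (sym (maxExponent-a[a+1]-% 6 a)) (sym (maxExponent-B 1 a))
  (toWitness {a? = allUpTo? (λ a → maxExponent (a * (a + 1)) 6 <? 6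
    →-dec maxExponent (B-iter (5 * a + 1)) 7 ≟ 1 + maxExponent (a * (a + 1)) 6) 64}
    _ (m%n<n a 64))

-- The index is 5(a + 1) + 2: here `a` stands for the a - 1 of the theorem, which avoids
-- subtraction.
maxExponent-B[5a+7] : ∀ a → maxExponent a 2 ≡ 2 → maxExponent (B (5 * a + 7)) 7 ≡ 3
maxExponent-B[5a+7] a = subst₂ (λ x y → x ≡ 2 → y ≡ 3)
  (sym (maxExponent-% 2 16 a)) (sym (maxExponent-B 7 a))
  (toWitness {a? = allUpTo? (λ a → maxExponent a 2 ≟ 2
    →-dec maxExponent (B-iter (5 * a + 7)) 7 ≟ 3) 64} _ (m%n<n a 64))

v₂-B[5a] : ∀ a → v₂ (+ a) ≤⁺ [ 2 ] → v₂ (+ B (5 * a)) ≡ [ 1 ] +∞ 2 ·∞ v₂ (+ a)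
v₂-B[5a] a le = trans
  (v₂-from-maxExponent 7
    (trans (cong (λ n → maxExponent (B n) 7) (sym (+-identityʳ (5 * a))))
      (maxExponent-B[5a] a (s≤s e≤2)))
    (s≤s (s≤s (≤-trans (*-monoʳ-≤ 2 e≤2) (n≤1+n 4)))))
  -- On a finite value, `2 ·∞ [ e ]` computes to `[ 2 * e ]`.
  (cong (λ v → [ 1 ] +∞ 2 ·∞ v) (sym (maxExponent<bound⇒v₂ a 3 (s≤s e≤2))))
  where e≤2 = v₂≤⇒maxExponent≤ a 3 le

v₂-B[5a+1] : ∀ a → v₂ (+ (a * (a + 1))) ≤⁺ [ 5 ] →
  v₂ (+ B (5 * a + 1)) ≡ [ 1 ] +∞ v₂ (+ (a * (a + 1)))
v₂-B[5a+1] a le = trans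
  (v₂-from-maxExponent 7 (maxExponent-B[5a+1] a (s≤s e≤5)) (s≤s (s≤s e≤5)))
  (cong ([ 1 ] +∞_) (sym (maxExponent<bound⇒v₂ (a * (a + 1)) 6 (s≤s e≤5))))
  where e≤5 = v₂≤⇒maxExponent≤ (a * (a + 1)) 6 le

v₂-B[5a+2] : ∀ a → [ 2 ] ≤⁺ v₂ (+ a - 1ℤ) → v₂ (+ B (5 * a + 2)) ≡ [ 3 ]
-- Here a - 1 = -1 has order 0, which is below 2.
v₂-B[5a+2] zero [ () ]
v₂-B[5a+2] (suc a) le = v₂-from-maxExponent 7
  (trans (cong (λ n → maxExponent (B n) 7) (shift a))
    (maxExponent-B[5a+7] a (≤v₂⇒maxExponent≡ a 2 le)))
  (s≤s (s≤s (s≤s (s≤s z≤n))))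
  where
  shift : ∀ a → 5 * suc a + 2 ≡ 5 * a + 7
  shift = solve-∀

v₂-B-odd : ∀ n → B (n % 5) % 2 ≡ 1 → v₂ (+ B n) ≡ [ 0 ]
v₂-B-odd n odd = v₂-from-maxExponent 1
  -- `B n` is compared modulo 2 with the number 1, whose order is 0.
  (maxExponent-cong-% (B n) 1 1 (trans (periodic⇒% (λ n → B n % 2) 5 B-periodic-2 n) odd))
  (s≤s z≤n)

theorem16 : ∀ (n : ℕ) →
    (∀ (a : ℕ) → n ≡ 5 * a → v₂ (+ a) ≤⁺ [ 2 ] →
    v₂ (+ B n) ≡ [ 1 ] +∞ 2 ·∞ v₂ (+ a))
    × (∀ (a : ℕ) → n ≡ 5 * a + 1 → v₂ (+ (a * (a + 1))) ≤⁺ [ 5 ] →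
    v₂ (+ B n) ≡ [ 1 ] +∞ v₂ (+ (a * (a + 1))))
    × (∀ (a : ℕ) → n ≡ 5 * a + 2 → [ 2 ] ≤⁺ v₂ (+ a - 1ℤ) →
    v₂ (+ B n) ≡ [ 3 ])
    × (n % 5 ≡ 3 → v₂ (+ B n) ≡ [ 0 ])
    × (n % 5 ≡ 4 → v₂ (+ B n) ≡ [ 0 ])
theorem16 n =
    (λ { a refl → v₂-B[5a] a })
  , (λ { a refl → v₂-B[5a+1] a })
  , (λ { a refl → v₂-B[5a+2] a })
  -- `B 3` and `B 4` both evaluate to 1.
  , (λ n%5≡3 → v₂-B-odd n (cong (λ r → B r % 2) n%5≡3))
  , (λ n%5≡4 → v₂-B-odd n (cong (λ r → B r % 2) n%5≡4))
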